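{- Axioms (DMV1')–(DMV4') are equivalent with axioms (DMV1)–(DMV2); that is, (DMV1')–(DMV4') is an equivalent definition of DMV-algebras. Precisely, let $A$ be an MV-algebra. (a) If $\{r \mid r\in[0,1]_{\mathbb Q}\}$ is a family of unary operators on $A$ satisfying (DMV1')–(DMV4'), then the operators $\delta_n(x):=\frac1n x$ ($n\ge 1$) satisfy (DMV1)–(DMV2). (b) If $\{\delta_n\}_{n\ge1}$ is a family of unary operators on $A$ satisfying (DMV1)–(DMV2), then the operators $\frac mn x:=m\,\delta_n(x)$ ($0\le m\le n$, $n\ge1$) are well defined and satisfy (DMV1')–(DMV4'). (c) These two assignments are mutually inverse.
   Context: An MV-algebra is a structure $(A,\oplus,{}^*,0)$ such that $(A,\oplus,0)$ is an Abelian monoid, $(x^*)^*=x$, $(x^*\oplus y)^*\oplus y=(y^*\oplus x)^*\oplus x$ and $0^*\oplus x=0^*$. Put $1=0^*$, $x\odot y=(x^*\oplus y^*)^*$, and for an integer $m\ge0$ let $mx=x\oplus\dots\oplus x$ ($m$ times, $0x=0$). Let $[0,1]_{\mathbb Q}=[0,1]\cap\mathbb Q$, with $r\odot q^*=\max\{0,r-q\}$ and $rq$ the product of rationals. A DMV-algebra is an MV-algebra $A$ endowed with unary operators $\{\delta_n\}_{n\ge 1}$ such that for all $x\in A$ and $n\ge1$: (DMV1) $n\delta_n x=x$; (DMV2) $\delta_n x\odot (n-1)\delta_n x=0$. For an MV-algebra $A$ endowed with unary operators $\{r\mid r\in[0,1]_{\mathbb Q}\}$ consider, for all $x,y\in A$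 and $r,q\in[0,1]_{\mathbb Q}$: (DMV1') $r(x\odot y^*)=(rx)\odot(ry)^*$; (DMV2') $(r\odot q^*)x=(rx)\odot(qx)^*$; (DMV3') $r(qx)=(rq)x$; (DMV4') $1x=x$. -}

module Defs where

open import Algebra.Bundles using (CommutativeMonoid)
open import Algebra.Core using (Op₁; Op₂)
import Algebra.Definitions as Definitions
import Algebra.Definitions.RawMonoid as RawMonoidDefinitions
open import Algebra.Structures using (IsCommutativeMonoid)
open import Data.Integer.Base as ℤ using (+_)
import Data.Integer.Properties as ℤ
import Data.Irrelevant as Irrelevant
open import Data.Nat.Base as ℕ using (ℕ; pred; NonZero)
import Data.Nat.Properties as ℕ
open import Data.Product.Base using (_×_; _,_)
open import Data.Rational.Base as ℚ using (ℚ; 0ℚ; 1ℚ; ↥_; ↧ₙ_)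
import Data.Rational.Properties as ℚ
import Data.Rational.Unnormalised.Base as ℚᵘ
import Data.Rational.Unnormalised.Properties as ℚᵘ
open import Data.Refinement.Base using (Refinement-syntax; value; proof)
  renaming (_,_ to _,ᴿ_)
open import Level using (suc; _⊔_)
open import Relation.Binary.Core using (Rel)
open import Relation.Binary.PropositionalEquality.Core using (_≡_)

-- As everywhere in the library's algebraic hierarchy, equality in the
-- algebra is an equivalence relation _≈_ respected by the operations.

record IsMVAlgebra {c ℓ} {A : Set c} (_≈_ : Rel A ℓ)
                   (_⊕_ : Op₂ A) (_* : Op₁ A) (0# : A) : Set (c ⊔ ℓ) where
  open Definitions _≈_
  field
    ⊕-isCommutativeMonoid : IsCommutativeMonoid _≈_ _⊕_ 0#
    *-cong                : Congruent₁ _*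
    *-involutive          : Involutive _*
    łukasiewicz           : ∀ x y → ((((x *) ⊕ y) *) ⊕ y) ≈ ((((y *) ⊕ x) *) ⊕ x)
    0*-zeroˡ              : LeftZero (0# *) _⊕_

record MVAlgebra c ℓ : Set (suc (c ⊔ ℓ)) where
  infix  9 _*
  infixr 8 _·_
  infixr 7 _⊙_
  infixr 6 _⊕_
  infix  4 _≈_
  field
    Carrier     : Set c
    _≈_         : Rel Carrier ℓ
    _⊕_         : Op₂ Carrier
    _*          : Op₁ Carrier
    0#          : Carrier
    isMVAlgebra : IsMVAlgebra _≈_ _⊕_ _* 0#

  open IsMVAlgebra isMVAlgebra public

  ⊕-commutativeMonoid : CommutativeMonoid c ℓ
  ⊕-commutativeMonoid = record { isCommutativeMonoid = ⊕-isCommutativeMonoid }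

  1# : Carrier
  1# = 0# *

  _⊙_ : Op₂ Carrier
  x ⊙ y = (x * ⊕ y *) *

  _·_ : ℕ → Carrier → Carrier
  _·_ = RawMonoidDefinitions._×_ (CommutativeMonoid.rawMonoid ⊕-commutativeMonoid)

-- The bounds are carried irrelevantly, so r ≡ s as soon as
-- value r ≡ value s.

[0,1]ℚ : Set
[0,1]ℚ = [ q ∈ ℚ ∣ (0ℚ ℚ.≤ q × q ℚ.≤ 1ℚ) ]

0≤m/n : ∀ m n .{{_ : NonZero n}} → 0ℚ ℚ.≤ + m ℚ./ n
0≤m/n m n = ℚ.nonNegative⁻¹ (+ m ℚ./ n) {{ℚ.normalize-nonNeg m n}}

m/n≤1 : ∀ {m} n .{{_ : NonZero n}} → m ℕ.≤ n → + m ℚ./ n ℚ.≤ 1ℚ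
m/n≤1 {m} n@(ℕ.suc n-1) m≤n = ℚ.toℚᵘ-cancel-≤ (begin
  ℚ.toℚᵘ (+ m ℚ./ n)   ≃⟨ ℚ.toℚᵘ-fromℚᵘ (ℚᵘ.mkℚᵘ (+ m) n-1) ⟩
  ℚᵘ.mkℚᵘ (+ m) n-1    ≤⟨ ℚᵘ.*≤* m*1≤1*n ⟩
  ℚᵘ.1ℚᵘ               ∎)
  where
  open ℚᵘ.≤-Reasoning
  m*1≤1*n : (+ m) ℤ.* (+ 1) ℤ.≤ (+ 1) ℤ.* (+ n)
  m*1≤1*n = ℤ.≤-trans (ℤ.*-monoʳ-≤-nonNeg (+ 1) (ℤ.+≤+ m≤n))
                      (ℤ.≤-reflexive (ℤ.*-comm (+ n) (+ 1)))

fraction : ∀ m n .{{_ : NonZero n}} → m ℕ.≤ n → [0,1]ℚ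
fraction m n m≤n = + m ℚ./ n ,ᴿ Irrelevant.[ 0≤m/n m n , m/n≤1 n m≤n ]

unitFraction : ∀ n .{{_ : NonZero n}} → [0,1]ℚ
unitFraction n = fraction 1 n (ℕ.>-nonZero⁻¹ n)

oneℚ : [0,1]ℚ
oneℚ = 1ℚ ,ᴿ Irrelevant.[ 0≤m/n 1 1 , ℚ.≤-refl ]

infixl 6 _⊖_
infixl 7 _⊗_

-- r ⊖ q is the element r ⊙ q* of the MV-algebra [0,1]ℚ.

_⊖_ : Op₂ [0,1]ℚ
r ⊖ q = 0ℚ ℚ.⊔ (value r ℚ.- value q) ,ᴿ Irrelevant.zipWith bounds (proof r) (proof q)
  where
  open ℚ.≤-Reasoning
  bounds : (0ℚ ℚ.≤ value r × value r ℚ.≤ 1ℚ) → (0ℚ ℚ.≤ value q × value q ℚ.≤ 1ℚ) →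
           0ℚ ℚ.≤ 0ℚ ℚ.⊔ (value r ℚ.- value q) × 0ℚ ℚ.⊔ (value r ℚ.- value q) ℚ.≤ 1ℚ
  bounds (0≤r , r≤1) (0≤q , q≤1) =
      ℚ.p≤p⊔q 0ℚ (value r ℚ.- value q)
    , ℚ.⊔-lub (0≤m/n 1 1) (begin
        value r ℚ.- value q   ≤⟨ ℚ.+-mono-≤ r≤1 (ℚ.neg-antimono-≤ 0≤q) ⟩
        1ℚ                    ∎)

_⊗_ : Op₂ [0,1]ℚ
r ⊗ q = value r ℚ.* value q ,ᴿ Irrelevant.zipWith bounds (proof r) (proof q)
  where
  open ℚ.≤-Reasoning
  bounds : (0ℚ ℚ.≤ value r × value r ℚ.≤ 1ℚ) → (0ℚ ℚ.≤ value q × value q ℚ.≤ 1ℚ) →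
           0ℚ ℚ.≤ value r ℚ.* value q × value r ℚ.* value q ℚ.≤ 1ℚ
  bounds (0≤r , r≤1) (0≤q , q≤1) =
      ℚ.nonNegative⁻¹ (value r ℚ.* value q)
        {{ℚ.nonNeg*nonNeg⇒nonNeg (value r) {{ℚ.nonNegative 0≤r}} (value q) {{ℚ.nonNegative 0≤q}}}}
    , (begin
        value r ℚ.* value q   ≤⟨ ℚ.*-monoˡ-≤-nonNeg (value r) {{ℚ.nonNegative 0≤r}} q≤1 ⟩
        value r ℚ.* 1ℚ        ≡⟨ ℚ.*-identityʳ (value r) ⟩
        value r               ≤⟨ r≤1 ⟩
        1ℚ                    ∎)

module _ {c ℓ} (A : MVAlgebra c ℓ) where
  open MVAlgebra A
  open Definitions _≈_ using (Congruent₁)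

  DivisionOperators : Set c
  DivisionOperators = ∀ n → .{{_ : NonZero n}} → Op₁ Carrier

  RationalOperators : Set c
  RationalOperators = [0,1]ℚ → Op₁ Carrier

  record IsDMVAlgebra (δ : DivisionOperators) : Set (c ⊔ ℓ) where
    field
      δ-cong : ∀ n .{{_ : NonZero n}} → Congruent₁ (δ n)
      dmv1   : ∀ n .{{_ : NonZero n}} x → n · δ n x ≈ x
      dmv2   : ∀ n .{{_ : NonZero n}} x → δ n x ⊙ (pred n · δ n x) ≈ 0#

  record IsDMVAlgebra′ (ρ : RationalOperators) : Set (c ⊔ ℓ) where
    field
      ρ-cong : ∀ r → Congruent₁ (ρ r)
      dmv1′  : ∀ r x y → ρ r (x ⊙ y *) ≈ ρ r x ⊙ (ρ r y) *
      dmv2′  : ∀ r q x → ρ (r ⊖ q) x ≈ ρ r x ⊙ (ρ q x) *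
      dmv3′  : ∀ r q x → ρ r (ρ q x) ≈ ρ (r ⊗ q) x
      dmv4′  : ∀ x → ρ oneℚ x ≈ x

  toDivision : RationalOperators → DivisionOperators
  toDivision ρ n = ρ (unitFraction n)

  -- The rule (m/n) x = m (δₙ x), read off at the fraction m/n in lowest
  -- terms; WellDefined says that every other representation of the same
  -- rational gives the same operator.

  toRational : DivisionOperators → RationalOperators
  toRational δ r x = ℤ.∣ ↥ value r ∣ · δ (↧ₙ value r) x

  record WellDefined (δ : DivisionOperators) : Set (c ⊔ ℓ) where
    field
      representation-independent :
        ∀ m n m′ n′ .{{_ : NonZero n}} .{{_ : NonZero n′}} →
        m ℕ.≤ n → m′ ℕ.≤ n′ → + m ℚ./ n ≡ + m′ ℚ./ n′ →
        ∀ x → m · δ n x ≈ m′ · δ n′ x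
      on-fractions :
        ∀ m n .{{_ : NonZero n}} (m≤n : m ℕ.≤ n) →
        ∀ x → toRational δ (fraction m n m≤n) x ≈ m · δ n x

{-# OPTIONS --safe #-}

-- The crux is that n-fold sums computed without truncation are compatible with x ⊖ y = x ⊙ y*:
-- if nx involves no truncation, then n(x ⊖ y) = nx ⊖ ny. Hence n-th parts are unique where they
-- exist, and DMV1–DMV2 say that δₙ x is the n-th part of x. Uniqueness makes δₙ commute with ⊖ and
-- gives δₘ δₙ = δₘₙ, from which the rational calculus follows by passing to common denominators.
-- Conversely, DMV2′ applied to (j + k)/n ⊖ k/n = j/n shows that (j + k)/n x is the untruncated sum
-- of j/n x and k/n x, so k/n x = k(1/n x).

module Submission where

open import Defs
open import Algebra.Bundles using (CommutativeMonoid)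
import Algebra.Properties.CommutativeMonoid.Mult as Multiples
import Algebra.Properties.CommutativeSemigroup as CommutativeSemigroupProperties
import Algebra.Properties.Group as GroupProperties
open import Data.Integer.Base as ℤ using (+_; -[1+_])
import Data.Integer.Properties as ℤ
import Data.Integer.Solver as ℤ-Solver
import Data.Irrelevant as Irrelevant
open import Data.Nat.Base as ℕ using (ℕ; zero; suc; pred; NonZero)
import Data.Nat.Properties as ℕ
open import Data.Product.Base using (_×_; _,_; proj₁; proj₂)
open import Data.Rational.Base as ℚ using (ℚ; 0ℚ; 1ℚ; ↥_; ↧ₙ_)
import Data.Rational.Properties as ℚ
import Data.Rational.Unnormalised.Base as ℚᵘ
import Data.Rational.Unnormalised.Properties as ℚᵘ
open import Data.Refinement.Base using (value; proof)
open import Data.Refinement.Properties using (value-injective)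
open import Data.Sum.Base using (inj₁; inj₂)
import Relation.Binary.Reasoning.Setoid as SetoidReasoning
open import Relation.Binary.PropositionalEquality as ≡ using (_≡_)
open import Relation.Nullary.Decidable.Core using (recompute)

-- Fractions of naturals as rationals.

/-cross-≡ : ∀ m n m′ n′ .{{_ : NonZero n}} .{{_ : NonZero n′}} →
            + m ℚ./ n ≡ + m′ ℚ./ n′ → m ℕ.* n′ ≡ m′ ℕ.* n
/-cross-≡ m n@(suc n-1) m′ n′@(suc n′-1) m/n≡m′/n′ = ℤ.+-injective (begin
  + (m ℕ.* n′)       ≡⟨ ℤ.pos-* m n′ ⟩
  + m ℤ.* + n′       ≡⟨ ℚᵘ.drop-*≡* (ℚ./-injective-≃ (ℚᵘ.mkℚᵘ (+ m) n-1) (ℚᵘ.mkℚᵘ (+ m′) n′-1) m/n≡m′/n′) ⟩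
  + m′ ℤ.* + n       ≡⟨ ℤ.pos-* m′ n ⟨
  + (m′ ℕ.* n)       ∎)
  where open ≡.≡-Reasoning

cross-≡⇒/-≡ : ∀ m n m′ n′ .{{_ : NonZero n}} .{{_ : NonZero n′}} →
              m ℕ.* n′ ≡ m′ ℕ.* n → + m ℚ./ n ≡ + m′ ℚ./ n′
cross-≡⇒/-≡ m n@(suc n-1) m′ n′@(suc n′-1) eq =
  ℚ.fromℚᵘ-cong {ℚᵘ.mkℚᵘ (+ m) n-1} {ℚᵘ.mkℚᵘ (+ m′) n′-1} (ℚᵘ.*≡* (begin
    + m ℤ.* + n′       ≡⟨ ℤ.pos-* m n′ ⟨
    + (m ℕ.* n′)       ≡⟨ ≡.cong +_ eq ⟩
    + (m′ ℕ.* n)       ≡⟨ ℤ.pos-* m′ n ⟩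
    + m′ ℤ.* + n       ∎))
  where open ≡.≡-Reasoning

/-homo-+ : ∀ i j n .{{_ : NonZero n}} → i ℚ./ n ℚ.+ j ℚ./ n ≡ (i ℤ.+ j) ℚ./ n
/-homo-+ i j n@(suc n-1) = ℚ.toℚᵘ-injective (begin-equality
  ℚ.toℚᵘ (i ℚ./ n ℚ.+ j ℚ./ n)                  ≃⟨ ℚ.toℚᵘ-homo-+ (i ℚ./ n) (j ℚ./ n) ⟩
  ℚ.toℚᵘ (i ℚ./ n) ℚᵘ.+ ℚ.toℚᵘ (j ℚ./ n)        ≃⟨ ℚᵘ.+-cong (ℚ.toℚᵘ-fromℚᵘ (ℚᵘ.mkℚᵘ i n-1))
                                                              (ℚ.toℚᵘ-fromℚᵘ (ℚᵘ.mkℚᵘ j n-1)) ⟩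
  ℚᵘ.mkℚᵘ i n-1 ℚᵘ.+ ℚᵘ.mkℚᵘ j n-1              ≃⟨ ℚᵘ.*≡* (≡.trans (identity i j (+ n))
                                                  (≡.cong ((i ℤ.+ j) ℤ.*_) (≡.sym (ℤ.pos-* n n)))) ⟩
  ℚᵘ.mkℚᵘ (i ℤ.+ j) n-1                         ≃⟨ ℚ.toℚᵘ-fromℚᵘ (ℚᵘ.mkℚᵘ (i ℤ.+ j) n-1) ⟨
  ℚ.toℚᵘ ((i ℤ.+ j) ℚ./ n)                      ∎)
  where
  open ℚᵘ.≤-Reasoning
  open ℤ-Solver.+-*-Solver
  identity : ∀ i j d → (i ℤ.* d ℤ.+ j ℤ.* d) ℤ.* d ≡ (i ℤ.+ j) ℤ.* (d ℤ.* d)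
  identity = solve 3 (λ i j d → (i :* d :+ j :* d) :* d := (i :+ j) :* (d :* d)) ≡.refl

/-homo-* : ∀ i j m n .{{_ : NonZero m}} .{{_ : NonZero n}} →
           (i ℚ./ m) ℚ.* (j ℚ./ n) ≡ ((i ℤ.* j) ℚ./ (m ℕ.* n)) {{ℕ.m*n≢0 m n}}
/-homo-* i j m@(suc m-1) n@(suc n-1) = ℚ.toℚᵘ-injective (begin-equality
  ℚ.toℚᵘ ((i ℚ./ m) ℚ.* (j ℚ./ n))              ≃⟨ ℚ.toℚᵘ-homo-* (i ℚ./ m) (j ℚ./ n) ⟩
  ℚ.toℚᵘ (i ℚ./ m) ℚᵘ.* ℚ.toℚᵘ (j ℚ./ n)        ≃⟨ ℚᵘ.*-cong (ℚ.toℚᵘ-fromℚᵘ (ℚᵘ.mkℚᵘ i m-1))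
                                                              (ℚ.toℚᵘ-fromℚᵘ (ℚᵘ.mkℚᵘ j n-1)) ⟩
  ℚᵘ.mkℚᵘ i m-1 ℚᵘ.* ℚᵘ.mkℚᵘ j n-1              ≃⟨ ℚ.toℚᵘ-fromℚᵘ (ℚᵘ.mkℚᵘ i m-1 ℚᵘ.* ℚᵘ.mkℚᵘ j n-1) ⟨
  ℚ.toℚᵘ ((i ℤ.* j) ℚ./ (m ℕ.* n))              ∎)
  where open ℚᵘ.≤-Reasoning

-- When b ≤ a, split a/n as (a ∸ b)/n + b/n and cancel b/n; otherwise the difference is at most 0
-- and both sides are 0.
/-homo-∸ : ∀ a b n .{{_ : NonZero n}} → 0ℚ ℚ.⊔ (+ a ℚ./ n ℚ.- + b ℚ./ n) ≡ + (a ℕ.∸ b) ℚ./ n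
/-homo-∸ a b n with ℕ.≤-total b a
... | inj₁ b≤a = begin
  0ℚ ℚ.⊔ (+ a ℚ./ n ℚ.- q)              ≡⟨ ≡.cong (λ k → 0ℚ ℚ.⊔ (+ k ℚ./ n ℚ.- q)) (ℕ.m∸n+n≡m b≤a) ⟨
  0ℚ ℚ.⊔ (+ (a ℕ.∸ b ℕ.+ b) ℚ./ n ℚ.- q)   ≡⟨ ≡.cong (λ r → 0ℚ ℚ.⊔ (r ℚ.- q)) (/-homo-+ (+ (a ℕ.∸ b)) (+ b) n) ⟨
  0ℚ ℚ.⊔ (+ (a ℕ.∸ b) ℚ./ n ℚ.+ q ℚ.- q)   ≡⟨ ≡.cong (0ℚ ℚ.⊔_) (//-rightDividesʳ q (+ (a ℕ.∸ b) ℚ./ n)) ⟩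
  0ℚ ℚ.⊔ + (a ℕ.∸ b) ℚ./ n              ≡⟨ ℚ.p≤q⇒p⊔q≡q (0≤m/n (a ℕ.∸ b) n) ⟩
  + (a ℕ.∸ b) ℚ./ n                     ∎
  where
  open ≡.≡-Reasoning
  open GroupProperties ℚ.+-0-group
  q = + b ℚ./ n
... | inj₂ a≤b = begin
  0ℚ ℚ.⊔ (p ℚ.- + b ℚ./ n)   ≡⟨ ℚ.p≥q⇒p⊔q≡p p-q≤0 ⟩
  0ℚ                         ≡⟨ ℚ.0/n≡0 n ⟨
  + 0 ℚ./ n                  ≡⟨ ≡.cong (λ k → + k ℚ./ n) (ℕ.m≤n⇒m∸n≡0 a≤b) ⟨
  + (a ℕ.∸ b) ℚ./ n          ∎
  where
  open ≡.≡-Reasoning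
  p = + a ℚ./ n
  p≤q : p ℚ.≤ + b ℚ./ n
  p≤q = ≡.subst₂ ℚ._≤_ (ℚ.+-identityʳ p)
    (≡.trans (/-homo-+ (+ a) (+ (b ℕ.∸ a)) n) (≡.cong (λ k → + k ℚ./ n) (ℕ.m+[n∸m]≡n a≤b)))
    (ℚ.+-monoʳ-≤ p (0≤m/n (b ℕ.∸ a) n))
  p-q≤0 : p ℚ.- + b ℚ./ n ℚ.≤ 0ℚ
  p-q≤0 = ≡.subst (p ℚ.- + b ℚ./ n ℚ.≤_) (ℚ.+-inverseʳ (+ b ℚ./ n)) (ℚ.+-monoˡ-≤ (ℚ.- (+ b ℚ./ n)) p≤q)

∣↥p∣/↧p≡p : ∀ p → 0ℚ ℚ.≤ p → + ℤ.∣ ↥ p ∣ ℚ./ ↧ₙ p ≡ p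
∣↥p∣/↧p≡p p@(ℚ.mkℚ (+ _)    _ _) 0≤p         = ℚ.↥p/↧p≡p p
∣↥p∣/↧p≡p p@(ℚ.mkℚ -[1+ _ ] _ _) (ℚ.*≤* ())

-- Links the lowest terms, through which `toRational` is defined, with an arbitrary representation
-- m/n.
∣↥m/n∣*n≡m*↧m/n : ∀ m n .{{_ : NonZero n}} →
                  ℤ.∣ ↥ (+ m ℚ./ n) ∣ ℕ.* n ≡ m ℕ.* ↧ₙ (+ m ℚ./ n)
∣↥m/n∣*n≡m*↧m/n m n =
  /-cross-≡ ℤ.∣ ↥ (+ m ℚ./ n) ∣ (↧ₙ (+ m ℚ./ n)) m n (∣↥p∣/↧p≡p (+ m ℚ./ n) (0≤m/n m n))

numerator denominator : [0,1]ℚ → ℕ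
numerator   r = ℤ.∣ ↥ value r ∣
denominator r = ↧ₙ value r

numerator/denominator : ∀ r → + numerator r ℚ./ denominator r ≡ value r
numerator/denominator r with proof r
-- The bounds are available only irrelevantly; decidability of ≤ makes them recomputable.
... | Irrelevant.[ bounds ] = ∣↥p∣/↧p≡p (value r) (recompute (0ℚ ℚ.≤? value r) (proj₁ bounds))

p≤1⇒∣↥p∣≤↧p : ∀ p → 0ℚ ℚ.≤ p → p ℚ.≤ 1ℚ → ℤ.∣ ↥ p ∣ ℕ.≤ ↧ₙ p
p≤1⇒∣↥p∣≤↧p p@(ℚ.mkℚ (+ m)    d-1 _) 0≤p        (ℚ.*≤* m*1≤1*d) =
  ℤ.drop‿+≤+ (≡.subst₂ ℤ._≤_ (ℤ.*-identityʳ (+ m)) (ℤ.*-identityˡ (+ suc d-1)) m*1≤1*d)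
p≤1⇒∣↥p∣≤↧p p@(ℚ.mkℚ -[1+ _ ] _ _) (ℚ.*≤* ()) _

numerator≤denominator : ∀ r → numerator r ℕ.≤ denominator r
numerator≤denominator r with proof r
... | Irrelevant.[ bounds ] = p≤1⇒∣↥p∣≤↧p (value r)
  (recompute (0ℚ ℚ.≤? value r) (proj₁ bounds)) (recompute (value r ℚ.≤? 1ℚ) (proj₂ bounds))

-- Elementary theory of MV-algebras.

module MVProperties {c ℓ} (A : MVAlgebra c ℓ) where
  open MVAlgebra A
  open CommutativeMonoid ⊕-commutativeMonoid
    using (setoid; refl; sym; trans; reflexive; commutativeSemigroup)
    renaming (∙-cong to ⊕-cong; ∙-congˡ to ⊕-congˡ; ∙-congʳ to ⊕-congʳ; assoc to ⊕-assoc;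
              comm to ⊕-comm; identityˡ to ⊕-identityˡ; identityʳ to ⊕-identityʳ) public
  open Multiples ⊕-commutativeMonoid
    using ()
    renaming (×-congʳ to ·-congʳ; ×-congˡ to ·-congˡ; ×-homo-1 to ·-homo-1; ×-homo-+ to ·-homo-+;
              ×-assocˡ to ·-assocˡ; ×-distrib-+ to ·-distrib-⊕) public
  open CommutativeSemigroupProperties commutativeSemigroup using (x∙yz≈y∙xz)
  open SetoidReasoning setoid

  ⊙-cong : ∀ {x x′ y y′} → x ≈ x′ → y ≈ y′ → x ⊙ y ≈ x′ ⊙ y′
  ⊙-cong x≈x′ y≈y′ = *-cong (⊕-cong (*-cong x≈x′) (*-cong y≈y′))

  ⊙-congˡ : ∀ {x y y′} → y ≈ y′ → x ⊙ y ≈ x ⊙ y′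
  ⊙-congˡ = ⊙-cong refl

  ⊙-congʳ : ∀ {x x′ y} → x ≈ x′ → x ⊙ y ≈ x′ ⊙ y
  ⊙-congʳ x≈x′ = ⊙-cong x≈x′ refl

  ⊙-comm : ∀ x y → x ⊙ y ≈ y ⊙ x
  ⊙-comm x y = *-cong (⊕-comm (x *) (y *))

  ⊙-* : ∀ x y → (x ⊙ y) * ≈ x * ⊕ y *
  ⊙-* x y = *-involutive _

  ⊕-* : ∀ x y → (x ⊕ y) * ≈ x * ⊙ y *
  ⊕-* x y = *-cong (⊕-cong (sym (*-involutive x)) (sym (*-involutive y)))

  ⊙-assoc : ∀ x y z → (x ⊙ y) ⊙ z ≈ x ⊙ (y ⊙ z)
  ⊙-assoc x y z = *-cong (begin
    (x ⊙ y) * ⊕ z *     ≈⟨ ⊕-congʳ (⊙-* x y) ⟩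
    (x * ⊕ y *) ⊕ z *   ≈⟨ ⊕-assoc (x *) (y *) (z *) ⟩
    x * ⊕ (y * ⊕ z *)   ≈⟨ ⊕-congˡ (⊙-* y z) ⟨
    x * ⊕ (y ⊙ z) *     ∎)

  ⊙-identityʳ : ∀ x → x ⊙ 1# ≈ x
  ⊙-identityʳ x = begin
    (x * ⊕ 1# *) *   ≈⟨ *-cong (⊕-congˡ (*-involutive 0#)) ⟩
    (x * ⊕ 0#) *     ≈⟨ *-cong (⊕-identityʳ (x *)) ⟩
    x * *            ≈⟨ *-involutive x ⟩
    x                ∎

  ⊙-zeroˡ : ∀ x → 0# ⊙ x ≈ 0#
  ⊙-zeroˡ x = trans (*-cong (0*-zeroˡ (x *))) (*-involutive 0#)

  ⊙-zeroʳ : ∀ x → x ⊙ 0# ≈ 0#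
  ⊙-zeroʳ x = trans (⊙-comm x 0#) (⊙-zeroˡ x)

  1*≈0 : 1# * ≈ 0#
  1*≈0 = *-involutive 0#

  -- Łukasiewicz's axiom for 1 and x: since 1* = 0, one side is x* ⊕ x, while the other is absorbed
  -- by 1.
  ⊕-complementˡ : ∀ x → x * ⊕ x ≈ 1#
  ⊕-complementˡ x = begin
    x * ⊕ x                ≈⟨ ⊕-congʳ (*-cong (⊕-identityˡ x)) ⟨
    (0# ⊕ x) * ⊕ x         ≈⟨ ⊕-congʳ (*-cong (⊕-congʳ 1*≈0)) ⟨
    (1# * ⊕ x) * ⊕ x       ≈⟨ łukasiewicz 1# x ⟩
    (x * ⊕ 1#) * ⊕ 1#      ≈⟨ ⊕-comm _ 1# ⟩
    1# ⊕ (x * ⊕ 1#) *      ≈⟨ 0*-zeroˡ _ ⟩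
    1#                     ∎

  ⊙-complementʳ : ∀ x → x ⊙ x * ≈ 0#
  ⊙-complementʳ x = trans (*-cong (trans (⊕-comm (x *) (x * *)) (⊕-complementˡ (x *)))) 1*≈0

  -- Both sides are the lattice join of x and y; up to double complements this is the Łukasiewicz
  -- axiom.
  join-comm : ∀ x y → x ⊙ y * ⊕ y ≈ y ⊙ x * ⊕ x
  join-comm x y = begin
    x ⊙ y * ⊕ y        ≈⟨ ⊕-congʳ (*-cong (⊕-congˡ (*-involutive y))) ⟩
    (x * ⊕ y) * ⊕ y    ≈⟨ łukasiewicz x y ⟩
    (y * ⊕ x) * ⊕ x    ≈⟨ ⊕-congʳ (*-cong (⊕-congˡ (*-involutive x))) ⟨
    y ⊙ x * ⊕ x        ∎

  -- x ⊖ (x ⊖ y) is the meet of x and y; its complement is the join of the complements, so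
  -- `join-comm` applies.
  meet-comm : ∀ x y → x ⊙ (x ⊙ y *) * ≈ y ⊙ (y ⊙ x *) *
  meet-comm x y = *-cong (begin
    x * ⊕ (x ⊙ y *) * *   ≈⟨ lemma x y ⟩
    y * ⊙ x * * ⊕ x *     ≈⟨ join-comm (y *) (x *) ⟩
    x * ⊙ y * * ⊕ y *     ≈⟨ lemma y x ⟨
    y * ⊕ (y ⊙ x *) * *   ∎)
    where
    lemma : ∀ x y → x * ⊕ (x ⊙ y *) * * ≈ y * ⊙ x * * ⊕ x *
    lemma x y = begin
      x * ⊕ (x ⊙ y *) * *   ≈⟨ ⊕-congˡ (*-involutive _) ⟩
      x * ⊕ x ⊙ y *         ≈⟨ ⊕-comm _ _ ⟩
      x ⊙ y * ⊕ x *         ≈⟨ ⊕-congʳ (⊙-comm x (y *)) ⟩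
      y * ⊙ x ⊕ x *         ≈⟨ ⊕-congʳ (⊙-congˡ (*-involutive x)) ⟨
      y * ⊙ x * * ⊕ x *     ∎

  -- The natural order and orthogonality.

  infix 4 _≼_ _⊥_

  _≼_ : Carrier → Carrier → Set ℓ
  x ≼ y = x ⊙ y * ≈ 0#

  -- Equivalent to x ≼ y *: the sum x ⊕ y involves no truncation.
  _⊥_ : Carrier → Carrier → Set ℓ
  x ⊥ y = x ⊙ y ≈ 0#

  ≼-difference : ∀ {x y} → x ≼ y → y ⊙ x * ⊕ x ≈ y
  ≼-difference {x} {y} x≼y = begin
    y ⊙ x * ⊕ x   ≈⟨ join-comm x y ⟨
    x ⊙ y * ⊕ y   ≈⟨ ⊕-congʳ x≼y ⟩
    0# ⊕ y        ≈⟨ ⊕-identityˡ y ⟩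
    y             ∎

  x≼x⊕y : ∀ x y → x ≼ x ⊕ y
  x≼x⊕y x y = begin
    x ⊙ (x ⊕ y) *       ≈⟨ ⊙-congˡ (⊕-* x y) ⟩
    x ⊙ (x * ⊙ y *)     ≈⟨ ⊙-assoc x (x *) (y *) ⟨
    (x ⊙ x *) ⊙ y *     ≈⟨ ⊙-congʳ (⊙-complementʳ x) ⟩
    0# ⊙ y *            ≈⟨ ⊙-zeroˡ (y *) ⟩
    0#                  ∎

  ≼-resp-≈ : ∀ {x x′ y y′} → x ≈ x′ → y ≈ y′ → x ≼ y → x′ ≼ y′
  ≼-resp-≈ x≈x′ y≈y′ x≼y = trans (sym (⊙-cong x≈x′ (*-cong y≈y′))) x≼y

  ≼-antisym : ∀ {x y} → x ≼ y → y ≼ x → x ≈ y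
  ≼-antisym {x} {y} x≼y y≼x = begin
    x             ≈⟨ ⊕-identityˡ x ⟨
    0# ⊕ x        ≈⟨ ⊕-congʳ y≼x ⟨
    y ⊙ x * ⊕ x   ≈⟨ ≼-difference x≼y ⟩
    y             ∎

  -- z ⊕ y is z ⊕ x plus the difference y ⊖ x, so `x≼x⊕y` applies; `≼-trans` rests on the same idea.
  ⊕-monoʳ-≼ : ∀ z {x y} → x ≼ y → z ⊕ x ≼ z ⊕ y
  ⊕-monoʳ-≼ z {x} {y} x≼y = ≼-resp-≈ refl eq (x≼x⊕y (z ⊕ x) (y ⊙ x *))
    where
    eq : (z ⊕ x) ⊕ y ⊙ x * ≈ z ⊕ y
    eq = trans (⊕-assoc z x _) (⊕-congˡ (trans (⊕-comm x _) (≼-difference x≼y)))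

  ≼-trans : ∀ {x y z} → x ≼ y → y ≼ z → x ≼ z
  ≼-trans {x} {y} {z} x≼y y≼z = ≼-resp-≈ refl eq (x≼x⊕y x (y ⊙ x * ⊕ z ⊙ y *))
    where
    eq : x ⊕ y ⊙ x * ⊕ z ⊙ y * ≈ z
    eq = begin
      x ⊕ (y ⊙ x * ⊕ z ⊙ y *)   ≈⟨ ⊕-assoc x _ _ ⟨
      (x ⊕ y ⊙ x *) ⊕ z ⊙ y *   ≈⟨ ⊕-congʳ (trans (⊕-comm x _) (≼-difference x≼y)) ⟩
      y ⊕ z ⊙ y *               ≈⟨ trans (⊕-comm y _) (≼-difference y≼z) ⟩
      z                         ∎

  x⊙y≼x : ∀ x y → x ⊙ y ≼ x
  x⊙y≼x x y = begin
    (x ⊙ y) ⊙ x *   ≈⟨ ⊙-congʳ (⊙-comm x y) ⟩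
    (y ⊙ x) ⊙ x *   ≈⟨ ⊙-assoc y x (x *) ⟩
    y ⊙ (x ⊙ x *)   ≈⟨ ⊙-congˡ (⊙-complementʳ x) ⟩
    y ⊙ 0#          ≈⟨ ⊙-zeroʳ y ⟩
    0#              ∎

  x⊙y≼y : ∀ x y → x ⊙ y ≼ y
  x⊙y≼y x y = ≼-resp-≈ (⊙-comm y x) refl (x⊙y≼x y x)

  ⊥-sym : ∀ {x y} → x ⊥ y → y ⊥ x
  ⊥-sym {x} {y} = trans (⊙-comm y x)

  ⊥-resp-≈ : ∀ {x x′ y y′} → x ≈ x′ → y ≈ y′ → x ⊥ y → x′ ⊥ y′
  ⊥-resp-≈ x≈x′ y≈y′ = trans (sym (⊙-cong x≈x′ y≈y′))

  ⊥⇒≼* : ∀ {x y} → x ⊥ y → x ≼ y *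
  ⊥⇒≼* x⊥y = trans (⊙-congˡ (*-involutive _)) x⊥y

  ≼*⇒⊥ : ∀ {x y} → x ≼ y * → x ⊥ y
  ≼*⇒⊥ x≼y* = trans (⊙-congˡ (sym (*-involutive _))) x≼y*

  ⊥-antiˡ : ∀ {x y z} → z ≼ x → x ⊥ y → z ⊥ y
  ⊥-antiˡ z≼x x⊥y = ≼*⇒⊥ (≼-trans z≼x (⊥⇒≼* x⊥y))

  ⊥-anti : ∀ {x x′ y y′} → x′ ≼ x → y′ ≼ y → x ⊥ y → x′ ⊥ y′
  ⊥-anti x′≼x y′≼y x⊥y = ⊥-sym (⊥-antiˡ y′≼y (⊥-sym (⊥-antiˡ x′≼x x⊥y)))

  -- The left side is the join of x * and y, and x ⊥ y puts y below x *.
  ⊥-*-cancel : ∀ {x y} → x ⊥ y → (x ⊕ y) * ⊕ y ≈ x *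
  ⊥-*-cancel {x} {y} x⊥y = begin
    (x ⊕ y) * ⊕ y        ≈⟨ ⊕-congʳ (⊕-* x y) ⟩
    x * ⊙ y * ⊕ y        ≈⟨ join-comm (x *) y ⟩
    y ⊙ x * * ⊕ x *      ≈⟨ ⊕-congʳ (⊥⇒≼* (⊥-sym x⊥y)) ⟩
    0# ⊕ x *             ≈⟨ ⊕-identityˡ (x *) ⟩
    x *                  ∎

  ⊕-⊖-cancel : ∀ {x y} → x ⊥ y → (x ⊕ y) ⊙ y * ≈ x
  ⊕-⊖-cancel {x} {y} x⊥y = begin
    (x ⊕ y) ⊙ y *          ≈⟨ *-cong (⊕-congˡ (*-involutive y)) ⟩
    ((x ⊕ y) * ⊕ y) *      ≈⟨ *-cong (⊥-*-cancel x⊥y) ⟩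
    x * *                  ≈⟨ *-involutive x ⟩
    x                      ∎

  -- Subtracting y ⊕ z means subtracting first z, which undoes the untruncated sum, and then y.
  ⊕-⊖-⊕-cancel : ∀ {x z} y → x ⊥ z → (x ⊕ z) ⊙ (y ⊕ z) * ≈ x ⊙ y *
  ⊕-⊖-⊕-cancel {x} {z} y x⊥z = begin
    (x ⊕ z) ⊙ (y ⊕ z) *      ≈⟨ ⊙-congˡ (trans (*-cong (⊕-comm y z)) (⊕-* z y)) ⟩
    (x ⊕ z) ⊙ (z * ⊙ y *)    ≈⟨ ⊙-assoc _ (z *) (y *) ⟨
    ((x ⊕ z) ⊙ z *) ⊙ y *    ≈⟨ ⊙-congʳ (⊕-⊖-cancel x⊥z) ⟩
    x ⊙ y *                  ∎

  -- From z ≼ (x ⊕ y) *, adding y gives y ⊕ z ≼ (x ⊕ y) * ⊕ y = x *.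
  ⊥-assoc : ∀ {x y z} → x ⊥ y → x ⊕ y ⊥ z → x ⊥ y ⊕ z
  ⊥-assoc {x} {y} {z} x⊥y xy⊥z = ⊥-sym (≼*⇒⊥
    (≼-resp-≈ refl (trans (⊕-comm y _) (⊥-*-cancel x⊥y))
      (⊕-monoʳ-≼ y (⊥⇒≼* (⊥-sym xy⊥z)))))

  -- Absence of truncation does not depend on the grouping: `⊥-assoc` isolates x, then z, and
  -- finally puts the two together.
  ⊥-interchange : ∀ {x y z w} → x ⊥ y → z ⊥ w → x ⊕ y ⊥ z ⊕ w → x ⊕ z ⊥ y ⊕ w
  ⊥-interchange {x} {y} {z} {w} x⊥y z⊥w xy⊥zw =
    ⊥-sym (⊥-resp-≈ refl (⊕-comm z x) (⊥-assoc (⊥-sym z⊥yw) (⊥-resp-≈ (⊕-comm z _) refl (⊥-sym x⊥zyw))))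
    where
    x⊥yzw : x ⊥ y ⊕ (z ⊕ w)
    x⊥yzw = ⊥-assoc x⊥y xy⊥zw
    x⊥zyw : x ⊥ z ⊕ (y ⊕ w)
    x⊥zyw = ⊥-resp-≈ refl (x∙yz≈y∙xz y z w) x⊥yzw
    y≼x⊕y : y ≼ x ⊕ y
    y≼x⊕y = ≼-resp-≈ refl (⊕-comm y x) (x≼x⊕y y x)
    z⊥yw : z ⊥ y ⊕ w
    z⊥yw = ⊥-resp-≈ refl (⊕-comm w y) (⊥-assoc z⊥w (⊥-sym (⊥-antiˡ y≼x⊕y xy⊥zw)))

  -- Meets and disjoint elements.

  -- x ∧ y = x ⊖ (x ⊖ y) vanishes precisely when x ⊖ y = x.
  Disjoint : Carrier → Carrier → Set ℓ
  Disjoint x y = x ⊙ y * ≈ x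

  disjoint-sym : ∀ {x y} → Disjoint x y → Disjoint y x
  disjoint-sym {x} {y} x∧y≈0 = ≼-antisym (x⊙y≼x y (x *)) meet≈0
    where
    meet≈0 : y ⊙ (y ⊙ x *) * ≈ 0#
    meet≈0 = begin
      y ⊙ (y ⊙ x *) *   ≈⟨ meet-comm y x ⟩
      x ⊙ (x ⊙ y *) *   ≈⟨ ⊙-congˡ (*-cong x∧y≈0) ⟩
      x ⊙ x *           ≈⟨ ⊙-complementʳ x ⟩
      0#                ∎

  disjoint-· : ∀ {x y} n → Disjoint x y → Disjoint x (n · y)
  disjoint-· {x} {y} zero    x∧y≈0 = ⊙-identityʳ x
  disjoint-· {x} {y} (suc n) x∧y≈0 = begin
    x ⊙ (y ⊕ n · y) *          ≈⟨ ⊙-congˡ (⊕-* y (n · y)) ⟩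
    x ⊙ y * ⊙ (n · y) *        ≈⟨ ⊙-assoc x (y *) _ ⟨
    (x ⊙ y *) ⊙ (n · y) *      ≈⟨ ⊙-congʳ x∧y≈0 ⟩
    x ⊙ (n · y) *              ≈⟨ disjoint-· n x∧y≈0 ⟩
    x                          ∎

  meet-decomposition : ∀ x y → x ⊙ y * ⊕ x ⊙ (x ⊙ y *) * ≈ x
  meet-decomposition x y = trans (⊕-comm _ _) (≼-difference (x⊙y≼x x (y *)))

  meet-decomposition′ : ∀ x y → y ⊙ x * ⊕ x ⊙ (x ⊙ y *) * ≈ y
  meet-decomposition′ x y = trans (⊕-congˡ (meet-comm x y)) (meet-decomposition y x)

  ⊖-⊥-meet : ∀ x y → x ⊙ y * ⊥ x ⊙ (x ⊙ y *) *
  ⊖-⊥-meet x y = ⊥-sym (≼*⇒⊥ (x⊙y≼y x ((x ⊙ y *) *)))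

  -- Adding the meet m to x ⊖ y and to y ⊖ x gives x and y; cancelling m again turns x ⊖ y into (x ⊖
  -- y) ⊖ (y ⊖ x).
  ⊖-disjoint : ∀ x y → Disjoint (x ⊙ y *) (y ⊙ x *)
  ⊖-disjoint x y = begin
    (x ⊙ y *) ⊙ (y ⊙ x *) *                    ≈⟨ ⊕-⊖-⊕-cancel (y ⊙ x *) (⊖-⊥-meet x y) ⟨
    (x ⊙ y * ⊕ m) ⊙ (y ⊙ x * ⊕ m) *            ≈⟨ ⊙-cong (meet-decomposition x y)
                                                         (*-cong (meet-decomposition′ x y)) ⟩
    x ⊙ y *                                    ∎
    where
    m : Carrier
    m = x ⊙ (x ⊙ y *) *

  -- Multiples and untruncated sums.

  ·-monoˡ-≼ : ∀ x {j k} → j ℕ.≤ k → j · x ≼ k · x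
  ·-monoˡ-≼ x {j} {k} j≤k =
    ≼-resp-≈ refl (trans (sym (·-homo-+ x j (k ℕ.∸ j))) (·-congˡ (ℕ.m+[n∸m]≡n j≤k)))
      (x≼x⊕y (j · x) ((k ℕ.∸ j) · x))

  ⊕-mono-≼ : ∀ {x x′ y y′} → x ≼ x′ → y ≼ y′ → x ⊕ y ≼ x′ ⊕ y′
  ⊕-mono-≼ {x} {x′} {y} {y′} x≼x′ y≼y′ =
    ≼-trans (⊕-monoʳ-≼ x y≼y′) (≼-resp-≈ (⊕-comm y′ x) (⊕-comm y′ x′) (⊕-monoʳ-≼ y′ x≼x′))

  ·-monoʳ-≼ : ∀ n {x y} → x ≼ y → n · x ≼ n · y
  ·-monoʳ-≼ zero    x≼y = ⊙-zeroˡ _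
  ·-monoʳ-≼ (suc n) x≼y = ⊕-mono-≼ x≼y (·-monoʳ-≼ n x≼y)

  -- The sum x ⊕ … ⊕ x of n copies involves no truncation.
  Proper : ℕ → Carrier → Set ℓ
  Proper n x = x ⊥ pred n · x

  proper-antiˡ : ∀ {m n x} → m ℕ.≤ n → Proper n x → Proper m x
  proper-antiˡ {x = x} m≤n p = ⊥-sym (⊥-antiˡ (·-monoˡ-≼ x (ℕ.pred-mono-≤ m≤n)) (⊥-sym p))

  -- Induction on j: the case of j and k + 1 gives jx ⊥ x ⊕ kx, and `⊥-assoc` carries one copy of x
  -- across.
  proper⇒⊥ : ∀ {n x} → Proper n x → ∀ j k → j ℕ.+ k ℕ.≤ n → j · x ⊥ k · x
  proper⇒⊥ {n} {x} p zero    k _ = ⊙-zeroˡ _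
  proper⇒⊥ {n} {x} p (suc j) k j+k<n =
    ⊥-sym (⊥-assoc (⊥-sym x⊥kx) (⊥-resp-≈ (⊕-comm x _) refl (⊥-sym jx⊥[1+k]x)))
    where
    x⊥kx : x ⊥ k · x
    x⊥kx = proper-antiˡ (ℕ.≤-trans (ℕ.+-monoʳ-≤ 1 (ℕ.m≤n+m k j)) j+k<n) p
    jx⊥[1+k]x : j · x ⊥ suc k · x
    jx⊥[1+k]x = proper⇒⊥ p j (suc k) (ℕ.≤-trans (ℕ.≤-reflexive (ℕ.+-suc j k)) j+k<n)

  proper-antiʳ : ∀ n {x y} → x ≼ y → Proper n y → Proper n x
  proper-antiʳ n x≼y = ⊥-anti x≼y (·-monoʳ-≼ (pred n) x≼y)

  proper-resp-≈ : ∀ n {x y} → x ≈ y → Proper n x → Proper n y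
  proper-resp-≈ n x≈y = ⊥-resp-≈ x≈y (·-congʳ (pred n) x≈y)

  -- One copy of x ⊕ y is peeled off at a time; `⊥-interchange` regroups (x ⊕ y) ⊕ (kx ⊕ ky) into x
  -- ⊕ kx and y ⊕ ky.
  proper-⊕⇒·-⊥ : ∀ {n x y} → x ⊥ y → Proper n (x ⊕ y) → ∀ k → k ℕ.≤ n → k · x ⊥ k · y
  proper-⊕⇒·-⊥ x⊥y p zero    _ = ⊙-zeroˡ _
  proper-⊕⇒·-⊥ {n} {x} {y} x⊥y p (suc k) k<n =
    ⊥-interchange x⊥y (proper-⊕⇒·-⊥ x⊥y p k (ℕ.<⇒≤ k<n))
      (⊥-resp-≈ (·-homo-1 _) (·-distrib-⊕ x y k) (proper⇒⊥ p 1 k k<n))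

  -- With d = x ⊖ y, e = y ⊖ x and m = x ∧ y, the n-fold multiples of x = d ⊕ m and y = e ⊕ m
  -- differ by nd ⊖ ne, and nd is disjoint from ne because d is disjoint from e.
  ·-distrib-⊖ : ∀ n {x} y → Proper n x → n · (x ⊙ y *) ≈ n · x ⊙ (n · y) *
  ·-distrib-⊖ n {x} y p = begin
    n · d                                   ≈⟨ nd∧ne ⟨
    n · d ⊙ (n · e) *                       ≈⟨ ⊕-⊖-⊕-cancel (n · e) nd⊥nm ⟨
    (n · d ⊕ n · m) ⊙ (n · e ⊕ n · m) *     ≈⟨ ⊙-cong (·-distrib-⊕ d m n) (*-cong (·-distrib-⊕ e m n)) ⟨
    n · (d ⊕ m) ⊙ (n · (e ⊕ m)) *           ≈⟨ ⊙-cong (·-congʳ n (meet-decomposition x y))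
                                                      (*-cong (·-congʳ n (meet-decomposition′ x y))) ⟩
    n · x ⊙ (n · y) *                       ∎
    where
    d e m : Carrier
    d = x ⊙ y *
    e = y ⊙ x *
    m = x ⊙ (x ⊙ y *) *
    nd∧ne : Disjoint (n · d) (n · e)
    nd∧ne = disjoint-· n (disjoint-sym (disjoint-· n (disjoint-sym (⊖-disjoint x y))))
    nd⊥nm : n · d ⊥ n · m
    nd⊥nm = proper-⊕⇒·-⊥ (⊖-⊥-meet x y) (proper-resp-≈ n (sym (meet-decomposition x y)) p) n ℕ.≤-refl

  x≼nx : ∀ n .{{_ : NonZero n}} x → x ≼ n · x
  x≼nx n x = ≼-resp-≈ (·-homo-1 x) refl (·-monoˡ-≼ x (ℕ.>-nonZero⁻¹ n))

  x≼0⇒x≈0 : ∀ {x} → x ≼ 0# → x ≈ 0#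
  x≼0⇒x≈0 {x} x≼0 = trans (sym (⊙-identityʳ x)) x≼0

  -- n(x ⊖ y) = nx ⊖ ny = 0, and x ⊖ y lies below its n-fold multiple because n is nonzero.
  ·-cancel-≼ : ∀ n .{{_ : NonZero n}} {x y} → Proper n x → n · x ≼ n · y → x ≼ y
  ·-cancel-≼ n {x} {y} p nx≼ny =
    x≼0⇒x≈0 (≼-resp-≈ refl (trans (·-distrib-⊖ n y p) nx≼ny) (x≼nx n (x ⊙ y *)))

  ·-cancel : ∀ n .{{_ : NonZero n}} {x y} → Proper n x → Proper n y → n · x ≈ n · y → x ≈ y
  ·-cancel n {x} {y} p q nx≈ny =
    ≼-antisym (·-cancel-≼ n p (≼-reflexive nx≈ny)) (·-cancel-≼ n q (≼-reflexive (sym nx≈ny)))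
    where
    ≼-reflexive : ∀ {u v} → u ≈ v → u ≼ v
    ≼-reflexive {u} {v} u≈v = ≼-resp-≈ refl u≈v (⊙-complementʳ u)

  proper-· : ∀ m n {x} → Proper (m ℕ.* n) x → Proper m (n · x)
  proper-· zero    n {x} p = ⊙-zeroʳ (n · x)
  proper-· (suc m) n {x} p = ⊥-resp-≈ refl (sym (·-assocˡ x m n)) (proper⇒⊥ p n (m ℕ.* n) ℕ.≤-refl)

  -- The mn - 1 copies beside x split into n - 1 copies, which complete its block, and m - 1 further
  -- blocks of n.
  proper-* : ∀ m n .{{_ : NonZero m}} .{{_ : NonZero n}} {x} →
             Proper n x → Proper m (n · x) → Proper (m ℕ.* n) x
  proper-* (suc m) (suc n) {x} p q = ⊥-resp-≈ refl
    (trans (⊕-congˡ (·-assocˡ x m (suc n))) (sym (·-homo-+ x n (m ℕ.* suc n)))) (⊥-assoc p q)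

  ·-distribʳ-∸ : ∀ {n x} a b → a ℕ.≤ n → Proper n x → (a ℕ.∸ b) · x ≈ a · x ⊙ (b · x) *
  ·-distribʳ-∸ {n} {x} a b a≤n p with ℕ.≤-total a b
  ... | inj₁ a≤b = trans (·-congˡ (ℕ.m≤n⇒m∸n≡0 a≤b)) (sym (·-monoˡ-≼ x a≤b))
  ... | inj₂ b≤a = begin
    (a ℕ.∸ b) · x                              ≈⟨ ⊕-⊖-cancel (proper⇒⊥ p (a ℕ.∸ b) b a∸b+b≤n) ⟨
    ((a ℕ.∸ b) · x ⊕ b · x) ⊙ (b · x) *        ≈⟨ ⊙-congʳ (·-homo-+ x (a ℕ.∸ b) b) ⟨
    (a ℕ.∸ b ℕ.+ b) · x ⊙ (b · x) *            ≈⟨ ⊙-congʳ (·-congˡ (ℕ.m∸n+n≡m b≤a)) ⟩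
    a · x ⊙ (b · x) *                          ∎
    where
    a∸b+b≤n : a ℕ.∸ b ℕ.+ b ℕ.≤ n
    a∸b+b≤n = ℕ.≤-trans (ℕ.≤-reflexive (ℕ.m∸n+n≡m b≤a)) a≤n

-- From division operators to rational operators.

module FromDivision {c ℓ} (A : MVAlgebra c ℓ) {δ : DivisionOperators A} (D : IsDMVAlgebra A δ) where
  open MVAlgebra A
  open MVProperties A
  open IsDMVAlgebra D
  open SetoidReasoning setoid

  -- Uniqueness of n-th parts is the tool for the laws of δ below: a candidate is checked to be
  -- untruncated and to have the right multiple.
  δ-unique : ∀ n .{{_ : NonZero n}} {x y} → Proper n y → n · y ≈ x → y ≈ δ n x
  δ-unique n {x} p ny≈x = ·-cancel n p (dmv2 n x) (trans ny≈x (sym (dmv1 n x)))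

  δ-distrib-⊖ : ∀ n .{{_ : NonZero n}} x y → δ n (x ⊙ y *) ≈ δ n x ⊙ (δ n y) *
  δ-distrib-⊖ n x y = sym (δ-unique n (proper-antiʳ n (x⊙y≼x (δ n x) _) (dmv2 n x)) (begin
    n · (δ n x ⊙ (δ n y) *)          ≈⟨ ·-distrib-⊖ n (δ n y) (dmv2 n x) ⟩
    n · δ n x ⊙ (n · δ n y) *        ≈⟨ ⊙-cong (dmv1 n x) (*-cong (dmv1 n y)) ⟩
    x ⊙ y *                          ∎))

  δ-congˡ : ∀ {m n} .{{_ : NonZero m}} .{{_ : NonZero n}} x → m ≡ n → δ m x ≈ δ n x
  δ-congˡ x ≡.refl = refl

  -- m copies rebuild δ n x without truncation, and n copies of that rebuild x without truncation.
  δ∘δ-proper : ∀ m n .{{_ : NonZero m}} .{{_ : NonZero n}} x → Proper (n ℕ.* m) (δ m (δ n x))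
  δ∘δ-proper m n x = proper-* n m (dmv2 m (δ n x)) (proper-resp-≈ n (sym (dmv1 m (δ n x))) (dmv2 n x))

  δ-∘ : ∀ m n .{{_ : NonZero m}} .{{_ : NonZero n}} x →
        δ m (δ n x) ≈ δ (n ℕ.* m) {{ℕ.m*n≢0 n m}} x
  δ-∘ m n x = δ-unique (n ℕ.* m) {{ℕ.m*n≢0 n m}} (δ∘δ-proper m n x) (begin
    (n ℕ.* m) · δ m (δ n x)     ≈⟨ ·-assocˡ _ n m ⟨
    n · (m · δ m (δ n x))       ≈⟨ ·-congʳ n (dmv1 m (δ n x)) ⟩
    n · δ n x                   ≈⟨ dmv1 n x ⟩
    x                           ∎)

  δ-· : ∀ m n k .{{_ : NonZero m}} .{{_ : NonZero n}} x → k ℕ.≤ n →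
        δ m (k · δ n x) ≈ k · δ m (δ n x)
  δ-· m n k x k≤n = sym (δ-unique m proper (begin
    m · (k · z)        ≈⟨ ·-assocˡ z m k ⟩
    (m ℕ.* k) · z      ≈⟨ ·-congˡ (ℕ.*-comm m k) ⟩
    (k ℕ.* m) · z      ≈⟨ ·-assocˡ z k m ⟨
    k · (m · z)        ≈⟨ ·-congʳ k (dmv1 m (δ n x)) ⟩
    k · δ n x          ∎))
    where
    z = δ m (δ n x)
    proper : Proper m (k · z)
    -- Since k ≤ n, the mk copies of z are among the nm copies known to be untruncated.
    proper = proper-· m k (proper-antiˡ (ℕ.≤-trans (ℕ.*-monoʳ-≤ m k≤n) (ℕ.≤-reflexive (ℕ.*-comm m n)))
                                        (δ∘δ-proper m n x))

  ·-δ-expand : ∀ m n k .{{_ : NonZero n}} .{{_ : NonZero k}} x →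
               m · δ n x ≈ (m ℕ.* k) · δ (n ℕ.* k) {{ℕ.m*n≢0 n k}} x
  ·-δ-expand m n k x = begin
    m · δ n x                                          ≈⟨ ·-congʳ m (dmv1 k (δ n x)) ⟨
    m · (k · δ k (δ n x))                              ≈⟨ ·-assocˡ _ m k ⟩
    (m ℕ.* k) · δ k (δ n x)                            ≈⟨ ·-congʳ (m ℕ.* k) (δ-∘ k n x) ⟩
    (m ℕ.* k) · δ (n ℕ.* k) {{ℕ.m*n≢0 n k}} x          ∎

  -- Both sides are refined to the common denominator n n′, where the numerators agree.
  ·-δ-cross : ∀ m n m′ n′ .{{_ : NonZero n}} .{{_ : NonZero n′}} →
              m ℕ.* n′ ≡ m′ ℕ.* n → ∀ x → m · δ n x ≈ m′ · δ n′ x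
  ·-δ-cross m n m′ n′ eq x = begin
    m · δ n x                                           ≈⟨ ·-δ-expand m n n′ x ⟩
    (m ℕ.* n′) · δ (n ℕ.* n′) {{nn′≢0}} x               ≈⟨ ·-congˡ eq ⟩
    (m′ ℕ.* n) · δ (n ℕ.* n′) {{nn′≢0}} x               ≈⟨ ·-congʳ (m′ ℕ.* n)
                                                           (δ-congˡ {{nn′≢0}} {{n′n≢0}} x (ℕ.*-comm n n′)) ⟩
    (m′ ℕ.* n) · δ (n′ ℕ.* n) {{n′n≢0}} x               ≈⟨ ·-δ-expand m′ n′ n x ⟨
    m′ · δ n′ x                                         ∎
    where
    nn′≢0 = ℕ.m*n≢0 n n′
    n′n≢0 = ℕ.m*n≢0 n′ n

  -- Frees `toRational` from lowest terms: the laws below evaluate it at whichever denominator is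
  -- convenient.
  toRational-≡ : ∀ r m n .{{_ : NonZero n}} → value r ≡ + m ℚ./ n →
                 ∀ x → toRational A δ r x ≈ m · δ n x
  toRational-≡ r m n value≡ = ·-δ-cross (numerator r) (denominator r) m n
    (≡.subst (λ p → ℤ.∣ ↥ p ∣ ℕ.* n ≡ m ℕ.* ↧ₙ p) (≡.sym value≡) (∣↥m/n∣*n≡m*↧m/n m n))

  wellDefined : WellDefined A δ
  wellDefined = record
    { representation-independent = λ m n m′ n′ _ _ eq → ·-δ-cross m n m′ n′ (/-cross-≡ m n m′ n′ eq)
    ; on-fractions               = λ m n m≤n → toRational-≡ (fraction m n m≤n) m n ≡.refl
    }

  toRational-distrib-⊖ : ∀ r x y →
                         toRational A δ r (x ⊙ y *) ≈ toRational A δ r x ⊙ (toRational A δ r y) *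
  toRational-distrib-⊖ r x y = begin
    m · δ n (x ⊙ y *)                ≈⟨ ·-congʳ m (δ-distrib-⊖ n x y) ⟩
    m · (δ n x ⊙ (δ n y) *)          ≈⟨ ·-distrib-⊖ m (δ n y)
                                        (proper-antiˡ (numerator≤denominator r) (dmv2 n x)) ⟩
    m · δ n x ⊙ (m · δ n y) *        ∎
    where
    m = numerator r
    n = denominator r

  toRational-⊖ : ∀ r q x → toRational A δ (r ⊖ q) x ≈ toRational A δ r x ⊙ (toRational A δ q x) *
  toRational-⊖ r q x = begin
    toRational A δ (r ⊖ q) x                         ≈⟨ toRational-≡ (r ⊖ q) (a ℕ.∸ b) N r⊖q≡ x ⟩
    (a ℕ.∸ b) · δ N x                                ≈⟨ ·-distribʳ-∸ a b a≤N (dmv2 N x) ⟩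
    a · δ N x ⊙ (b · δ N x) *                        ≈⟨ ⊙-cong (toRational-≡ r a N r≡ x)
                                                               (*-cong (toRational-≡ q b N q≡ x)) ⟨
    toRational A δ r x ⊙ (toRational A δ q x) *      ∎
    where
    -- Over the common denominator N, r becomes a/N and q becomes b/N.
    N = denominator r ℕ.* denominator q
    a = numerator r ℕ.* denominator q
    b = denominator r ℕ.* numerator q
    a≤N : a ℕ.≤ N
    a≤N = ℕ.*-monoˡ-≤ (denominator q) (numerator≤denominator r)
    r≡ : value r ≡ + a ℚ./ N
    r≡ = ≡.trans (≡.sym (numerator/denominator r))
      (cross-≡⇒/-≡ (numerator r) (denominator r) a N
        (≡.trans (≡.cong (numerator r ℕ.*_) (ℕ.*-comm (denominator r) (denominator q)))
          (≡.sym (ℕ.*-assoc (numerator r) (denominator q) (denominator r)))))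
    q≡ : value q ≡ + b ℚ./ N
    q≡ = ≡.trans (≡.sym (numerator/denominator q))
      (cross-≡⇒/-≡ (numerator q) (denominator q) b N
        (≡.trans (≡.sym (ℕ.*-assoc (numerator q) (denominator r) (denominator q)))
          (≡.cong (ℕ._* denominator q) (ℕ.*-comm (numerator q) (denominator r)))))
    r⊖q≡ : value (r ⊖ q) ≡ + (a ℕ.∸ b) ℚ./ N
    r⊖q≡ = ≡.trans (≡.cong₂ (λ u v → 0ℚ ℚ.⊔ (u ℚ.- v)) r≡ q≡) (/-homo-∸ a b N)

  toRational-∘ : ∀ r q x → toRational A δ r (toRational A δ q x) ≈ toRational A δ (r ⊗ q) x
  toRational-∘ r q x = begin
    m · δ n (m′ · δ n′ x)                     ≈⟨ ·-congʳ m (δ-· n n′ m′ x (numerator≤denominator q)) ⟩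
    m · (m′ · δ n (δ n′ x))                   ≈⟨ ·-assocˡ _ m m′ ⟩
    (m ℕ.* m′) · δ n (δ n′ x)                 ≈⟨ ·-congʳ (m ℕ.* m′) (δ-∘ n n′ x) ⟩
    (m ℕ.* m′) · δ (n′ ℕ.* n) x               ≈⟨ ·-congʳ (m ℕ.* m′) (δ-congˡ x (ℕ.*-comm n′ n)) ⟩
    (m ℕ.* m′) · δ (n ℕ.* n′) x               ≈⟨ toRational-≡ (r ⊗ q) (m ℕ.* m′) (n ℕ.* n′) r⊗q≡ x ⟨
    toRational A δ (r ⊗ q) x                  ∎
    where
    m  = numerator r
    n  = denominator r
    m′ = numerator q
    n′ = denominator q
    r⊗q≡ : value (r ⊗ q) ≡ + (m ℕ.* m′) ℚ./ (n ℕ.* n′)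
    r⊗q≡ = ≡.trans (≡.cong₂ ℚ._*_ (≡.sym (numerator/denominator r)) (≡.sym (numerator/denominator q)))
      (≡.trans (/-homo-* (+ m) (+ m′) n n′) (≡.cong (λ i → i ℚ./ (n ℕ.* n′)) (≡.sym (ℤ.pos-* m m′))))

  isDMVAlgebra′ : IsDMVAlgebra′ A (toRational A δ)
  isDMVAlgebra′ = record
    { ρ-cong = λ r x≈y → ·-congʳ (numerator r) (δ-cong (denominator r) x≈y)
    ; dmv1′  = toRational-distrib-⊖
    ; dmv2′  = toRational-⊖
    ; dmv3′  = toRational-∘
    -- The lowest terms of 1 are 1/1, so `toRational` at `oneℚ` computes to the 1-fold multiple of δ
    -- 1 x.
    ; dmv4′  = dmv1 1
    }

  toDivision-toRational : ∀ n .{{_ : NonZero n}} x → toDivision A (toRational A δ) n x ≈ δ n x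
  toDivision-toRational n x = trans (toRational-≡ (unitFraction n) 1 n ≡.refl x) (·-homo-1 (δ n x))

-- From rational operators to division operators.

module FromRational {c ℓ} (A : MVAlgebra c ℓ) {ρ : RationalOperators A} (D : IsDMVAlgebra′ A ρ) where
  open MVAlgebra A
  open MVProperties A
  open IsDMVAlgebra′ D
  open SetoidReasoning setoid

  ρ-value-cong : ∀ r s → value r ≡ value s → ∀ x → ρ r x ≈ ρ s x
  ρ-value-cong r s eq x = reflexive (≡.cong (λ t → ρ t x) (value-injective eq))

  ρ-fraction-∸ : ∀ {j k l} n .{{_ : NonZero n}} (j≤n : j ℕ.≤ n) (k≤n : k ℕ.≤ n) (l≤n : l ℕ.≤ n) →
                 j ℕ.∸ k ≡ l → ∀ x →
                 ρ (fraction l n l≤n) x ≈ ρ (fraction j n j≤n) x ⊙ (ρ (fraction k n k≤n) x) *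
  ρ-fraction-∸ {j} {k} {l} n j≤n k≤n l≤n eq x = begin
    ρ (fraction l n l≤n) x                                        ≈⟨ ρ-value-cong _ _ value≡ x ⟨
    ρ (fraction j n j≤n ⊖ fraction k n k≤n) x                     ≈⟨ dmv2′ _ _ x ⟩
    ρ (fraction j n j≤n) x ⊙ (ρ (fraction k n k≤n) x) *           ∎
    where
    value≡ : value (fraction j n j≤n ⊖ fraction k n k≤n) ≡ + l ℚ./ n
    value≡ = ≡.trans (/-homo-∸ j k n) (≡.cong (λ i → + i ℚ./ n) eq)

  -- As 0 ∸ 0 = 0, DMV2′ exhibits this element as its own difference with itself.
  ρ-0/n : ∀ n .{{_ : NonZero n}} x → ρ (fraction 0 n ℕ.z≤n) x ≈ 0#
  ρ-0/n n x = trans (ρ-fraction-∸ n ℕ.z≤n ℕ.z≤n ℕ.z≤n ≡.refl x) (⊙-complementʳ _)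

  module _ j k n .{{_ : NonZero n}} (j+k≤n : j ℕ.+ k ℕ.≤ n) (x : Carrier) where
    private
      j≤n = ℕ.m+n≤o⇒m≤o j j+k≤n
      k≤n = ℕ.m+n≤o⇒n≤o j j+k≤n
      a = ρ (fraction (j ℕ.+ k) n j+k≤n) x
      b = ρ (fraction k n k≤n) x

      ρj≈a⊖b : ρ (fraction j n j≤n) x ≈ a ⊙ b *
      ρj≈a⊖b = ρ-fraction-∸ n j+k≤n k≤n j≤n (ℕ.m+n∸n≡m j k) x

      -- Since k ∸ (j + k) = 0, DMV2′ identifies b ⊖ a with 0/n applied to x.
      b≼a : b ≼ a
      b≼a = trans (sym (ρ-fraction-∸ n k≤n j+k≤n ℕ.z≤n (ℕ.m≤n⇒m∸n≡0 (ℕ.m≤n+m k j)) x)) (ρ-0/n n x)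

    -- The left element is a ⊖ b, which lies below b *.
    ρ-fraction-⊥ : ρ (fraction j n j≤n) x ⊥ b
    ρ-fraction-⊥ = ⊥-resp-≈ (sym ρj≈a⊖b) refl (≼*⇒⊥ (x⊙y≼y a (b *)))

    ρ-fraction-+ : ρ (fraction (j ℕ.+ k) n j+k≤n) x ≈ ρ (fraction j n j≤n) x ⊕ b
    ρ-fraction-+ = trans (sym (≼-difference b≼a)) (⊕-congʳ (sym ρj≈a⊖b))

  ρ-fraction : ∀ k n .{{_ : NonZero n}} (k≤n : k ℕ.≤ n) x →
               ρ (fraction k n k≤n) x ≈ k · ρ (unitFraction n) x
  ρ-fraction zero    n _   x = ρ-0/n n x
  -- One summand 1/n is split off; its bounds are irrelevant, so its operator is that of
  -- `unitFraction n`.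
  ρ-fraction (suc k) n k<n x = trans (ρ-fraction-+ 1 k n k<n x) (⊕-congˡ (ρ-fraction k n (ℕ.<⇒≤ k<n) x))

  isDMVAlgebra : IsDMVAlgebra A (toDivision A ρ)
  isDMVAlgebra = record
    { δ-cong = λ n → ρ-cong (unitFraction n)
    ; dmv1   = λ n x → begin
        n · ρ (unitFraction n) x        ≈⟨ ρ-fraction n n ℕ.≤-refl x ⟨
        ρ (fraction n n ℕ.≤-refl) x     ≈⟨ ρ-value-cong _ oneℚ (cross-≡⇒/-≡ n n 1 1 (ℕ.*-comm n 1)) x ⟩
        ρ oneℚ x                        ≈⟨ dmv4′ x ⟩
        x                               ∎
    -- As 1 + pred n = n, the elements for 1/n and (n - 1)/n are orthogonal, and the latter is the
    -- (n - 1)-fold multiple of the former.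
    ; dmv2   = λ n x → ⊥-resp-≈ refl (ρ-fraction (pred n) n ℕ.pred[n]≤n x)
        (ρ-fraction-⊥ 1 (pred n) n (ℕ.≤-reflexive (ℕ.suc-pred n)) x)
    }

  toRational-toDivision : ∀ r x → toRational A (toDivision A ρ) r x ≈ ρ r x
  toRational-toDivision r x = begin
    m · ρ (unitFraction n) x      ≈⟨ ρ-fraction m n m≤n x ⟨
    ρ (fraction m n m≤n) x        ≈⟨ ρ-value-cong _ r (numerator/denominator r) x ⟩
    ρ r x                         ∎
    where
    m   = numerator r
    n   = denominator r
    m≤n = numerator≤denominator r

corollary2p1 : ∀ {c ℓ} (A : MVAlgebra c ℓ) → let open MVAlgebra A in
    (∀ ρ → IsDMVAlgebra′ A ρ → IsDMVAlgebra A (toDivision A ρ))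
    × (∀ δ → IsDMVAlgebra A δ → WellDefined A δ × IsDMVAlgebra′ A (toRational A δ))
    × (∀ ρ → IsDMVAlgebra′ A ρ →
         ∀ r x → toRational A (toDivision A ρ) r x ≈ ρ r x)
    × (∀ δ → IsDMVAlgebra A δ →
         ∀ n .{{_ : NonZero n}} x → toDivision A (toRational A δ) n x ≈ δ n x)
corollary2p1 A =
    (λ ρ D → FromRational.isDMVAlgebra A D)
  , (λ δ D → FromDivision.wellDefined A D , FromDivision.isDMVAlgebra′ A D)
  , (λ ρ D → FromRational.toRational-toDivision A D)
  , (λ δ D → FromDivision.toDivision-toRational A D)
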